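{- Let $M_0=\begin{pmatrix} x_1 & x_2 & x_3\\ y_1 & y_2 & y_3\end{pmatrix}$ be an integer matrix with $\frac{y_1}{x_1}<\frac{y_2}{x_2}<\frac{y_3}{x_3}$, put $Y_{ij}=x_iy_j-x_jy_i$ for $i<j$, and suppose $Y_{12},Y_{13},Y_{23}$ are pairwise relatively prime. For $\mathbf n=(n_1,n_2)^T\in\overline\Omega_1\cap\mathbb Z^2$, $$f(M_0,\mathbf n)<\frac{Y_{12}Y_{13}-Y_{12}-Y_{13}+1}{n_2x_1-n_1y_1}.$$ For $\mathbf n=(n_1,n_2)^T\in\overline\Omega_2\cap\mathbb Z^2$, $$f(M_0,\mathbf n)<\frac{Y_{23}Y_{13}-Y_{23}-Y_{13}+1}{n_1y_3-n_2x_3}.$$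
   Context: $f(M_0,\mathbf n)$ denotes the largest integer $N$ for which the linear Diophantine system $M_0\mathbf x=N\mathbf n$ has no solution $\mathbf x\in\mathbb Z_{\ge0}^3$. The convex hull of the columns of $M_0$ is assumed not to contain the origin. $\mathrm{cone}(M_0)$ is the set of nonnegative real combinations of the columns of $M_0$; $\Omega_1=\{(x,y)^T\in\mathrm{cone}(M_0): \frac{y_1}{x_1}<\frac yx<\frac{y_2}{x_2}\}$ and $\Omega_2=\{(x,y)^T\in\mathrm{cone}(M_0): \frac{y_2}{x_2}<\frac yx<\frac{y_3}{x_3}\}$, and the bar denotes closure.
   Formalization: Y_13 > 0 is added (the columns are in angular order); without it the claim fails, e.g. columns (1,0),(1,2),(-1,-3), n=(1,1): bound -4 but f ≥ -1. Denominators are taken nonzero; cone, hull and closure use rational points, with the same integer n. -}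

module Defs where

open import Data.Fin using (Fin)
open import Data.Fin.Patterns using (0F; 1F; 2F)
open import Data.Integer using (ℤ; +_)
open import Data.Integer.Properties as ℤₚ using ()
open import Data.Nat using (ℕ)
open import Data.Product using (Σ-syntax; ∃-syntax; _×_)
open import Data.Rational using (ℚ; 0ℚ; 1ℚ; _÷_; NonZero)
open import Data.Rational.Literals using (fromℤ)
open import Data.Rational.Properties as ℚₚ using ()
open import Function using (_∘_)
open import Relation.Binary.PropositionalEquality using (_≡_)
open import Relation.Nullary using (¬_)
open import Relation.Unary using (Pred)
open import Level using (0ℓ)

import Algebra.Properties.Monoid.Sum as Sum
import Data.Integer as ℤ
import Data.Rational as ℚ

open Sum ℤₚ.+-0-monoid using () renaming (sum to sumℤ)
open Sum ℚₚ.+-0-monoid using () renaming (sum to sumℚ)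

-- Row 0F holds the xⱼ and row 1F the yⱼ.
Matrix : Set
Matrix = Fin 2 → Fin 3 → ℤ

ℤ² ℚ² : Set
ℤ² = Fin 2 → ℤ
ℚ² = Fin 2 → ℚ

column : Matrix → Fin 3 → ℤ²
column M j i = M i j

embed : ℤ² → ℚ²
embed v = fromℤ ∘ v

Y : Matrix → Fin 3 → Fin 3 → ℤ
Y M i j = M 0F i ℤ.* M 1F j ℤ.- M 0F j ℤ.* M 1F i

Solvable : Matrix → ℤ² → Pred ℤ 0ℓ
Solvable M n N =
  Σ[ c ∈ (Fin 3 → ℕ) ] (∀ i → sumℤ (λ j → M i j ℤ.* + c j) ≡ N ℤ.* n i)

IsLargest : Pred ℤ 0ℓ → Pred ℤ 0ℓ
IsLargest P N = P N × (∀ K → P K → K ℤ.≤ N)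

-- IsFrobenius M n N says that f(M, n) exists and equals N.
IsFrobenius : Matrix → ℤ² → Pred ℤ 0ℓ
IsFrobenius M n = IsLargest (λ N → ¬ Solvable M n N)

combination : Matrix → (Fin 3 → ℚ) → ℚ²
combination M t i = sumℚ (λ j → fromℤ (M i j) ℚ.* t j)

-- All planar sets below are the rational points of their real counterparts.
-- As M has integer entries, a rational point that is a nonnegative (or convex)
-- combination of the columns with real coefficients is one with rational
-- coefficients.

Cone : Matrix → Pred ℚ² 0ℓ
Cone M p = ∃[ t ] (∀ j → 0ℚ ℚ.≤ t j) × (∀ i → p i ≡ combination M t i)

ConvexHull : Matrix → Pred ℚ² 0ℓ
ConvexHull M p =
  ∃[ t ] (∀ j → 0ℚ ℚ.≤ t j) × sumℚ t ≡ 1ℚ × (∀ i → p i ≡ combination M t i)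

origin : ℚ²
origin _ = 0ℚ

slope : (p : ℚ²) .{{_ : NonZero (p 0F)}} → ℚ
slope p = p 1F ÷ p 0F

-- The slopes determine the directions of the columns only up to sign. Together
-- with the hull avoiding the origin, 0 < Y₁₃ makes increasing slope the angular
-- order of the columns. Without 0 < Y₁₃ the bounds can fail: for columns (1,0),
-- (1,2), (-1,-3) and n = (1,1) the first one would read f < -4, while f ≥ -1.
columnSlope : (M : Matrix) {{_ : ∀ {j} → ℤ.NonZero (M 0F j)}} → Fin 3 → ℚ
columnSlope M {{x≢0}} j = slope (embed (column M j)) {{x≢0 {j}}}

-- The points of the cone whose slope lies strictly between those of columns
-- j and k, so Ω₁ = Sector M 0F 1F and Ω₂ = Sector M 1F 2F.
Sector : (M : Matrix) {{_ : ∀ {j} → ℤ.NonZero (M 0F j)}} →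
         Fin 3 → Fin 3 → Pred ℚ² 0ℓ
Sector M j k p =
  Cone M p ×
  (Σ[ x≢0 ∈ NonZero (p 0F) ]
     columnSlope M j ℚ.< slope p {{x≢0}} × slope p {{x≢0}} ℚ.< columnSlope M k)

-- Topological closure, in the sup metric. The sectors are relatively open
-- convex cones with rational generators, so their rational points are dense in
-- them and this gives the rational points of the real closure.
Closure : Pred ℚ² 0ℓ → Pred ℚ² 0ℓ
Closure S p =
  ∀ ε → 0ℚ ℚ.< ε → ∃[ q ] S q × (∀ i → ℚ.∣ q i ℚ.- p i ∣ ℚ.< ε)

Ω̄₁ Ω̄₂ : (M : Matrix) {{_ : ∀ {j} → ℤ.NonZero (M 0F j)}} → Pred ℤ² 0ℓ
Ω̄₁ M n = Closure (Sector M 0F 1F) (embed n)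
Ω̄₂ M n = Closure (Sector M 1F 2F) (embed n)

infixl 7 _÷ℤ_

_÷ℤ_ : (a b : ℤ) .{{_ : ℤ.NonZero b}} → ℚ
(a ÷ℤ b) {{b≢0}} = (fromℤ a ÷ fromℤ b) {{b≢0}}

{-# OPTIONS --safe #-}
module Submission where

-- Let D = det (v₁ , n) and E = det (n , v₂). By Cramer's rule in the basis
-- v₁ , v₂, the system M (a , b , c) = N n is equivalent to
--
--   Y₁₂ b + Y₁₃ c = N D   and   Y₁₂ a = N E + Y₂₃ c.
--
-- As D Y₂₃ + E Y₁₃ is a multiple of Y₁₂ and Y₁₃ is prime to Y₁₂, the first
-- equation makes Y₁₂ divide N E + Y₂₃ c, and E ≥ 0 then yields a ≥ 0. So N is
-- solvable once N D is a nonnegative combination of the coprime Y₁₂ and Y₁₃,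
-- which by Sylvester holds from (Y₁₂ − 1)(Y₁₃ − 1) on. Solvability is decidable
-- and fails at −1, hence there is a largest unsolvable N.
-- The second bound is the first one for the matrix reflected in the diagonal
-- with its columns reversed.

open import Defs
open import Data.Fin using (Fin; opposite)
open import Data.Fin.Patterns using (0F; 1F; 2F)
open import Data.Integer using
  (ℤ; +_; +0; +[1+_]; -[1+_]; 0ℤ; 1ℤ; -1ℤ; _+_; _-_; -_; _*_; _<_; _≤_; NonZero; ∣_∣;
   +≤+; +<+; -<+; -≤+; -≤-)
open import Data.Integer.Coprimality using (Coprime)
open import Data.Integer.Tactic.RingSolver using (solve-∀)
open import Data.Nat using (ℕ; zero; suc)
open import Data.Product using (_×_; ∃-syntax; ∃₂; _,_)
open import Data.Rational using (ℚ; 0ℚ; 1ℚ)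
open import Data.Rational.Literals using (fromℤ)
open import Data.Rational.Solver using (module +-*-Solver)
open import Data.Sum using (inj₁; inj₂)
open import Function using (_∘_; case_of_)
open import Level using (0ℓ)
open import Relation.Binary.Definitions using (tri<; tri≈; tri>)
open import Relation.Binary.PropositionalEquality
  using (_≡_; _≢_; refl; sym; trans; cong; cong₂; subst; subst₂; module ≡-Reasoning)
open import Relation.Nullary using (¬_; Dec; yes; no; contradiction)
open import Relation.Nullary.Decidable using (map′; _×-dec_)
open import Relation.Unary using (Pred)
import Algebra.Properties.Monoid.Sum as Sum
import Data.Integer.Coprimality as ℤ
import Data.Integer.DivMod as ℤ
import Data.Integer.Properties as ℤ
import Data.Nat as ℕ
import Data.Nat.Coprimality as ℕ
import Data.Nat.Divisibility as ℕ
import Data.Nat.GCD as ℕ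
import Data.Nat.Properties as ℕ
import Data.Nat.Tactic.RingSolver as ℕ-ring
import Data.Rational as ℚ
import Data.Rational.Properties as ℚ
import Data.Rational.Unnormalised.Properties as ℚᵘ

open Sum ℚ.+-0-monoid using () renaming (sum to sumℚ)
open +-*-Solver using (solve; _:+_; _:-_; :-_; _:*_; _:=_; con)

-- Two coprime coins: Sylvester's bound.

bézout : ∀ {m n} → ℕ.Coprime m n → ∃₂ λ s u → s * + m + u * + n ≡ 1ℤ
bézout {m} {n} coprime with ℕ.coprime-Bézout coprime
... | ℕ.Bézout.+- x y eq = + x , - (+ y) , (begin
  + x * + m + - (+ y) * + n        ≡⟨ cong₂ _+_ (ℤ.pos-* x m) (ℤ.neg-distribˡ-* (+ y) (+ n)) ⟨
  + (x ℕ.* m) - + y * + n          ≡⟨ cong (λ k → + k - + y * + n) eq ⟨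
  1ℤ + + (y ℕ.* n) - + y * + n     ≡⟨ cong (λ i → 1ℤ + i - + y * + n) (ℤ.pos-* y n) ⟩
  1ℤ + + y * + n - + y * + n       ≡⟨ cancel (+ y * + n) ⟩
  1ℤ                               ∎)
  where
  open ≡-Reasoning
  cancel : ∀ i → 1ℤ + i - i ≡ 1ℤ
  cancel = solve-∀
... | ℕ.Bézout.-+ x y eq = - (+ x) , + y , (begin
  - (+ x) * + m + + y * + n              ≡⟨ cong (λ i → - (+ x) * + m + i) (ℤ.pos-* y n) ⟨
  - (+ x) * + m + + (y ℕ.* n)            ≡⟨ cong (λ k → - (+ x) * + m + + k) eq ⟨
  - (+ x) * + m + (1ℤ + + (x ℕ.* m))     ≡⟨ cong (λ i → - (+ x) * + m + (1ℤ + i)) (ℤ.pos-* x m) ⟩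
  - (+ x) * + m + (1ℤ + + x * + m)       ≡⟨ cancel (+ x) (+ m) ⟩
  1ℤ                                     ∎)
  where
  open ≡-Reasoning
  cancel : ∀ i j → - i * j + (1ℤ + i * j) ≡ 1ℤ
  cancel = solve-∀

-- Bézout gives t = t s P + t u Q. Reducing the coefficient t u of Q modulo P leaves c ≤ p, and the
-- removed multiple of P is made up for in `b`. A negative `b` would force t + P ≤ Q c ≤ Q p, that
-- is, t < p q.
two-coins : ∀ {p q} → ℕ.Coprime (suc p) (suc q) → ∀ t → p ℕ.* q ℕ.≤ t →
            ∃₂ λ b c → suc p ℕ.* b ℕ.+ suc q ℕ.* c ≡ t
two-coins {p} {q} coprime t pq≤t with bézout coprime
... | s , u , su≡1 = quotient b refl
  where
  open ≡-Reasoning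
  P Q w b : ℤ
  P = + suc p
  Q = + suc q
  c : ℕ
  c = (+ t * u) ℤ.%ℕ suc p
  w = (+ t * u) ℤ./ℕ suc p
  b = + t * s + Q * w

  regroup : ∀ P Q t s w c → P * (t * s + Q * w) + Q * c ≡ t * s * P + Q * (c + w * P)
  regroup = solve-∀

  factor : ∀ P Q t s u → t * s * P + Q * (t * u) ≡ t * (s * P + u * Q)
  factor = solve-∀

  combination≡t : P * b + Q * + c ≡ + t
  combination≡t = begin
    P * b + Q * + c                     ≡⟨ regroup P Q (+ t) s w (+ c) ⟩
    + t * s * P + Q * (+ c + w * P)     ≡⟨ cong (λ i → + t * s * P + Q * i) (ℤ.a≡a%ℕn+[a/ℕn]*n (+ t * u) (suc p)) ⟨
    + t * s * P + Q * (+ t * u)         ≡⟨ factor P Q (+ t) s u ⟩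
    + t * (s * P + u * Q)               ≡⟨ cong (+ t *_) su≡1 ⟩
    + t * 1ℤ                            ≡⟨ ℤ.*-identityʳ (+ t) ⟩
    + t                                 ∎

  c≤p : c ℕ.≤ p
  c≤p = ℕ.≤-pred (ℤ.n%ℕd<d (+ t * u) (suc p))

  quotient : ∀ i → b ≡ i → ∃₂ λ b c → suc p ℕ.* b ℕ.+ suc q ℕ.* c ≡ t
  quotient (+ n) b≡n = n , c , ℤ.+-injective (begin
    + (suc p ℕ.* n ℕ.+ suc q ℕ.* c)        ≡⟨ cong₂ _+_ (ℤ.pos-* (suc p) n) (ℤ.pos-* (suc q) c) ⟩
    P * + n + Q * + c                      ≡⟨ cong (λ i → P * i + Q * + c) b≡n ⟨
    P * b + Q * + c                        ≡⟨ combination≡t ⟩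
    + t                                    ∎)
  quotient -[1+ n ] b≡-1-n = contradiction t+P≤Qp (ℕ.<⇒≱ Qp<t+P)
    where
    move : ∀ P Q c n → P * (- n) + Q * c + P * n ≡ Q * c
    move = solve-∀

    t+P[1+n]≡Qc : t ℕ.+ suc p ℕ.* suc n ≡ suc q ℕ.* c
    t+P[1+n]≡Qc = ℤ.+-injective (begin
      + t + + (suc p ℕ.* suc n)                  ≡⟨ cong₂ _+_ (sym combination≡t) (ℤ.pos-* (suc p) (suc n)) ⟩
      P * b + Q * + c + P * + suc n              ≡⟨ cong (λ i → P * i + Q * + c + P * + suc n) b≡-1-n ⟩
      P * -[1+ n ] + Q * + c + P * + suc n       ≡⟨ move P Q (+ c) (+ suc n) ⟩
      Q * + c                                    ≡⟨ ℤ.pos-* (suc q) c ⟨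
      + (suc q ℕ.* c)                            ∎)

    t+P≤Qp : t ℕ.+ suc p ℕ.≤ suc q ℕ.* p
    t+P≤Qp = ℕ.≤-trans (ℕ.+-monoʳ-≤ t (ℕ.m≤m*n (suc p) (suc n)))
               (ℕ.≤-trans (ℕ.≤-reflexive t+P[1+n]≡Qc) (ℕ.*-monoʳ-≤ (suc q) c≤p))

    Qp<t+P : suc q ℕ.* p ℕ.< t ℕ.+ suc p
    Qp<t+P = subst₂ ℕ._<_ (trans (ℕ.+-comm (p ℕ.* q) p) (cong (p ℕ.+_) (ℕ.*-comm p q))) (sym (ℕ.+-suc t p))
               (ℕ.s≤s (ℕ.+-monoˡ-≤ p pq≤t))

-- The reduced system: decidability and large multiples.

-- M (a , b , c) = k n after Cramer's rule, with p = Y₁₂, q = Y₁₃, r = Y₂₃, d = D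
-- and e = E.
System : (p q r d e : ℕ) → Pred ℕ 0ℓ
System p q r d e k =
  ∃₂ λ c b → ∃[ a ] p ℕ.* b ℕ.+ q ℕ.* c ≡ k ℕ.* d × p ℕ.* a ≡ k ℕ.* e ℕ.+ r ℕ.* c

-- As both coefficients are positive, the first equation confines b and c to at most k d, so a
-- finite search decides. The second equation is then a divisibility statement, with `a` as its
-- quotient.
system? : ∀ p q r d e k → Dec (System (suc p) (suc q) r d e k)
system? p q r d e k = map′ weaken strengthen
  (ℕ.anyUpTo? (λ c → ℕ.anyUpTo? (λ b →
    (suc p ℕ.* b ℕ.+ suc q ℕ.* c ℕ.≟ k ℕ.* d) ×-dec
    (suc p ℕ.∣? k ℕ.* e ℕ.+ r ℕ.* c)) t) t)
  where
  t : ℕ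
  -- The search bounds are strict, while b and c may equal k d.
  t = suc (k ℕ.* d)

  Bounded : Set
  Bounded = ∃[ c ] c ℕ.< t × ∃[ b ] b ℕ.< t ×
              suc p ℕ.* b ℕ.+ suc q ℕ.* c ≡ k ℕ.* d × suc p ℕ.∣ k ℕ.* e ℕ.+ r ℕ.* c

  weaken : Bounded → System (suc p) (suc q) r d e k
  weaken (c , _ , b , _ , eq , ℕ.divides a eq′) =
    c , b , a , eq , trans (ℕ.*-comm (suc p) a) (sym eq′)

  strengthen : System (suc p) (suc q) r d e k → Bounded
  strengthen (c , b , a , eq , eq′) =
    c , ℕ.s≤s (ℕ.≤-trans (ℕ.m≤n*m c (suc q)) (ℕ.m+n≤o⇒n≤o (suc p ℕ.* b) (ℕ.≤-reflexive eq))) ,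
    b , ℕ.s≤s (ℕ.≤-trans (ℕ.m≤n*m b (suc p)) (ℕ.m+n≤o⇒m≤o (suc p ℕ.* b) (ℕ.≤-reflexive eq))) ,
    eq , ℕ.divides a (trans (sym eq′) (ℕ.*-comm (suc p) a))

-- Substituting k d = P b + Q c into k (d r + e Q) shows that P divides Q (k e + r c), and
-- coprimality removes Q. The divisibility hypothesis will come from `plücker`; the quotient is
-- nonnegative because `e` and `r` are natural numbers.
system-solvable : ∀ {p q r d e} → ℕ.Coprime (suc p) (suc q) → suc p ℕ.∣ d ℕ.* r ℕ.+ e ℕ.* suc q →
                  ∀ k → p ℕ.* q ℕ.≤ k ℕ.* d → System (suc p) (suc q) r d e k
system-solvable {p} {q} {r} {d} {e} coprime p∣dr+eq k pq≤kd with two-coins coprime (k ℕ.* d) pq≤kd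
... | b , c , eq = c , b , a , eq , trans (ℕ.*-comm (suc p) a) (sym (ℕ._∣_.equality p∣ke+rc))
  where
  open ≡-Reasoning
  expand : ∀ k d r e q → k ℕ.* (d ℕ.* r ℕ.+ e ℕ.* q) ≡ r ℕ.* (k ℕ.* d) ℕ.+ k ℕ.* e ℕ.* q
  expand = ℕ-ring.solve-∀

  collect : ∀ p q r b c x → r ℕ.* (p ℕ.* b ℕ.+ q ℕ.* c) ℕ.+ x ℕ.* q ≡ r ℕ.* b ℕ.* p ℕ.+ q ℕ.* (x ℕ.+ r ℕ.* c)
  collect = ℕ-ring.solve-∀

  split : k ℕ.* (d ℕ.* r ℕ.+ e ℕ.* suc q) ≡ r ℕ.* b ℕ.* suc p ℕ.+ suc q ℕ.* (k ℕ.* e ℕ.+ r ℕ.* c)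
  split = begin
    k ℕ.* (d ℕ.* r ℕ.+ e ℕ.* suc q)                                ≡⟨ expand k d r e (suc q) ⟩
    r ℕ.* (k ℕ.* d) ℕ.+ k ℕ.* e ℕ.* suc q                          ≡⟨ cong (λ t → r ℕ.* t ℕ.+ k ℕ.* e ℕ.* suc q) eq ⟨
    r ℕ.* (suc p ℕ.* b ℕ.+ suc q ℕ.* c) ℕ.+ k ℕ.* e ℕ.* suc q      ≡⟨ collect (suc p) (suc q) r b c (k ℕ.* e) ⟩
    r ℕ.* b ℕ.* suc p ℕ.+ suc q ℕ.* (k ℕ.* e ℕ.+ r ℕ.* c)          ∎

  p∣ke+rc : suc p ℕ.∣ k ℕ.* e ℕ.+ r ℕ.* c
  p∣ke+rc = ℕ.coprime-divisor coprime
    (ℕ.∣m+n∣m⇒∣n (subst (suc p ℕ.∣_) split (ℕ.∣n⇒∣m*n k p∣dr+eq)) (ℕ.n∣m*n (r ℕ.* b)))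

  a : ℕ
  a = ℕ.quotient p∣ke+rc

-- The threshold is lowered one by one until the value just below it fails. If no natural number
-- fails, the answer is -1, so decisions are asked for only at natural numbers.
largest-failure : ∀ {P : Pred ℤ 0ℓ} → (∀ k → Dec (P (+ k))) → ¬ P -1ℤ →
                  ∀ K → (∀ k → K ℕ.≤ k → P (+ k)) → ∃[ f ] IsLargest (¬_ ∘ P) f
largest-failure {P} P? ¬P[-1] zero P≥K = -1ℤ , ¬P[-1] , below
  where
  below : ∀ i → ¬ P i → i ≤ -1ℤ
  below (+ k)    ¬Pk = contradiction (P≥K k ℕ.z≤n) ¬Pk
  below -[1+ k ] ¬Pk = -≤- ℕ.z≤n
largest-failure {P} P? ¬P[-1] (suc K) P>K with P? K
... | no ¬PK = + K , ¬PK , below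
  where
  below : ∀ i → ¬ P i → i ≤ + K
  below (+ k)    ¬Pk = +≤+ (ℕ.≮⇒≥ (¬Pk ∘ P>K k))
  below -[1+ k ] ¬Pk = -≤+
... | yes PK = largest-failure P? ¬P[-1] K P≥K
  where
  P≥K : ∀ k → K ℕ.≤ k → P (+ k)
  P≥K k K≤k with K ℕ.≟ k
  ... | yes refl = PK
  ... | no  K≢k  = P>K k (ℕ.≤∧≢⇒< K≤k K≢k)

-- Cramer's rule and the bound over the integers.

det : ℤ² → ℤ² → ℤ
det u v = u 0F * v 1F - v 0F * u 1F

0≤⇒+ : ∀ {i} → 0ℤ ≤ i → ∃[ k ] i ≡ + k
0≤⇒+ (+≤+ {n = k} _) = k , refl

0<⇒+suc : ∀ {i} → 0ℤ < i → ∃[ k ] i ≡ + suc k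
0<⇒+suc (+<+ {n = suc k} _) = k , refl

module _ (M : Matrix) (n : ℤ²) where
  private
    x₁ = M 0F 0F
    x₂ = M 0F 1F
    x₃ = M 0F 2F
    y₁ = M 1F 0F
    y₂ = M 1F 1F
    y₃ = M 1F 2F
    n₁ = n 0F
    n₂ = n 1F
    Y₁₂ = Y M 0F 1F
    Y₁₃ = Y M 0F 2F
    Y₂₃ = Y M 1F 2F
    -- The factors are ordered as in the denominator of the theorem, whereas `E` is literally the
    -- unfolding of `det n (column M 1F)`.
    D = n₂ * x₁ - n₁ * y₁
    E = n₁ * y₂ - x₂ * n₂

    open ≡-Reasoning

  -- Applying det (v₁ , ·) to both sides of the system annihilates the first column.
  det-first : ∀ N ((c , _) : Solvable M n N) → Y₁₂ * + c 1F + Y₁₃ * + c 2F ≡ N * D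
  det-first N (c , eq) = begin
    Y₁₂ * b + Y₁₃ * c′                                         ≡⟨ expand x₁ x₂ x₃ y₁ y₂ y₃ a b c′ ⟩
    (y₁ * a + (y₂ * b + (y₃ * c′ + 0ℤ))) * x₁ -
      (x₁ * a + (x₂ * b + (x₃ * c′ + 0ℤ))) * y₁                ≡⟨ cong₂ (λ i j → i * x₁ - j * y₁) (eq 1F) (eq 0F) ⟩
    N * n₂ * x₁ - N * n₁ * y₁                                  ≡⟨ factor N n₂ x₁ n₁ y₁ ⟩
    N * D                                                      ∎
    where
    a = + c 0F
    b = + c 1F
    c′ = + c 2F
    expand : ∀ x₁ x₂ x₃ y₁ y₂ y₃ a b c →
      (x₁ * y₂ - x₂ * y₁) * b + (x₁ * y₃ - x₃ * y₁) * c ≡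
      (y₁ * a + (y₂ * b + (y₃ * c + 0ℤ))) * x₁ - (x₁ * a + (x₂ * b + (x₃ * c + 0ℤ))) * y₁
    expand = solve-∀
    factor : ∀ N n₂ x n₁ y → N * n₂ * x - N * n₁ * y ≡ N * (n₂ * x - n₁ * y)
    factor = solve-∀

  -- Applying det (· , v₂) annihilates the second column; the third contributes - Y₂₃ c, which is
  -- moved to the right.
  det-second : ∀ N ((c , _) : Solvable M n N) → Y₁₂ * + c 0F ≡ N * E + Y₂₃ * + c 2F
  det-second N (c , eq) = begin
    Y₁₂ * a                                                    ≡⟨ expand x₁ x₂ x₃ y₁ y₂ y₃ a b c′ ⟩
    (x₁ * a + (x₂ * b + (x₃ * c′ + 0ℤ))) * y₂ -
      x₂ * (y₁ * a + (y₂ * b + (y₃ * c′ + 0ℤ))) + Y₂₃ * c′     ≡⟨ cong₂ (λ i j → i * y₂ - x₂ * j + Y₂₃ * c′) (eq 0F) (eq 1F) ⟩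
    N * n₁ * y₂ - x₂ * (N * n₂) + Y₂₃ * c′                     ≡⟨ cong (_+ Y₂₃ * c′) (factor N n₁ y₂ x₂ n₂) ⟩
    N * E + Y₂₃ * c′                                           ∎
    where
    a = + c 0F
    b = + c 1F
    c′ = + c 2F
    expand : ∀ x₁ x₂ x₃ y₁ y₂ y₃ a b c →
      (x₁ * y₂ - x₂ * y₁) * a ≡
      (x₁ * a + (x₂ * b + (x₃ * c + 0ℤ))) * y₂ - x₂ * (y₁ * a + (y₂ * b + (y₃ * c + 0ℤ))) +
      (x₂ * y₃ - x₃ * y₂) * c
    expand = solve-∀
    factor : ∀ N n₁ y x n₂ → N * n₁ * y - x * (N * n₂) ≡ N * (n₁ * y - x * n₂)
    factor = solve-∀

  -- Each coordinate is checked after multiplication by Y₁₂, using Y₁₂ v₃ = Y₁₃ v₂ - Y₂₃ v₁ and Y₁₂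
  -- n = E v₁ + D v₂.
  dets⇒solvable : ∀ N .{{_ : NonZero Y₁₂}} (c : Fin 3 → ℕ) →
                  Y₁₂ * + c 1F + Y₁₃ * + c 2F ≡ N * D →
                  Y₁₂ * + c 0F ≡ N * E + Y₂₃ * + c 2F →
                  Solvable M n N
  dets⇒solvable N c eq₁ eq₂ = c , λ where
      0F → ℤ.*-cancelˡ-≡ Y₁₂ _ _ (begin
        Y₁₂ * (x₁ * a + (x₂ * b + (x₃ * c′ + 0ℤ)))     ≡⟨ expand-x x₁ x₂ x₃ y₁ y₂ y₃ a b c′ ⟩
        x₁ * (Y₁₂ * a) + x₂ * (Y₁₂ * b + Y₁₃ * c′) - x₁ * (Y₂₃ * c′)
                                                       ≡⟨ cong₂ (λ i j → x₁ * i + x₂ * j - x₁ * (Y₂₃ * c′)) eq₂ eq₁ ⟩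
        x₁ * (N * E + Y₂₃ * c′) + x₂ * (N * D) - x₁ * (Y₂₃ * c′)
                                                       ≡⟨ regroup-x x₁ x₂ y₁ y₂ n₁ n₂ N (Y₂₃ * c′) ⟩
        Y₁₂ * (N * n₁)                                 ∎)
      1F → ℤ.*-cancelˡ-≡ Y₁₂ _ _ (begin
        Y₁₂ * (y₁ * a + (y₂ * b + (y₃ * c′ + 0ℤ)))     ≡⟨ expand-y x₁ x₂ x₃ y₁ y₂ y₃ a b c′ ⟩
        y₁ * (Y₁₂ * a) + y₂ * (Y₁₂ * b + Y₁₃ * c′) - y₁ * (Y₂₃ * c′)
                                                       ≡⟨ cong₂ (λ i j → y₁ * i + y₂ * j - y₁ * (Y₂₃ * c′)) eq₂ eq₁ ⟩
        y₁ * (N * E + Y₂₃ * c′) + y₂ * (N * D) - y₁ * (Y₂₃ * c′)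
                                                       ≡⟨ regroup-y x₁ x₂ y₁ y₂ n₁ n₂ N (Y₂₃ * c′) ⟩
        Y₁₂ * (N * n₂)                                 ∎)
    where
    a = + c 0F
    b = + c 1F
    c′ = + c 2F
    expand-x : ∀ x₁ x₂ x₃ y₁ y₂ y₃ a b c →
      (x₁ * y₂ - x₂ * y₁) * (x₁ * a + (x₂ * b + (x₃ * c + 0ℤ))) ≡
      x₁ * ((x₁ * y₂ - x₂ * y₁) * a) + x₂ * ((x₁ * y₂ - x₂ * y₁) * b + (x₁ * y₃ - x₃ * y₁) * c) -
      x₁ * ((x₂ * y₃ - x₃ * y₂) * c)
    expand-x = solve-∀
    expand-y : ∀ x₁ x₂ x₃ y₁ y₂ y₃ a b c →
      (x₁ * y₂ - x₂ * y₁) * (y₁ * a + (y₂ * b + (y₃ * c + 0ℤ))) ≡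
      y₁ * ((x₁ * y₂ - x₂ * y₁) * a) + y₂ * ((x₁ * y₂ - x₂ * y₁) * b + (x₁ * y₃ - x₃ * y₁) * c) -
      y₁ * ((x₂ * y₃ - x₃ * y₂) * c)
    expand-y = solve-∀
    regroup-x : ∀ x₁ x₂ y₁ y₂ n₁ n₂ N s →
      x₁ * (N * (n₁ * y₂ - x₂ * n₂) + s) + x₂ * (N * (n₂ * x₁ - n₁ * y₁)) - x₁ * s ≡
      (x₁ * y₂ - x₂ * y₁) * (N * n₁)
    regroup-x = solve-∀
    regroup-y : ∀ x₁ x₂ y₁ y₂ n₁ n₂ N s →
      y₁ * (N * (n₁ * y₂ - x₂ * n₂) + s) + y₂ * (N * (n₂ * x₁ - n₁ * y₁)) - y₁ * s ≡
      (x₁ * y₂ - x₂ * y₁) * (N * n₂)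
    regroup-y = solve-∀

  -- The three-term Plücker relation for v₁ , v₂ , v₃ , n; the cofactor of Y₁₂ is det (n , v₃).
  plücker : D * Y₂₃ + E * Y₁₃ ≡ Y₁₂ * (n₁ * y₃ - x₃ * n₂)
  plücker = identity x₁ x₂ x₃ y₁ y₂ y₃ n₁ n₂
    where
    identity : ∀ x₁ x₂ x₃ y₁ y₂ y₃ n₁ n₂ →
      (n₂ * x₁ - n₁ * y₁) * (x₂ * y₃ - x₃ * y₂) + (n₁ * y₂ - x₂ * n₂) * (x₁ * y₃ - x₃ * y₁) ≡
      (x₁ * y₂ - x₂ * y₁) * (n₁ * y₃ - x₃ * n₂)
    identity = solve-∀

  -- The bound is stated without division and from signs of determinants alone, so that it also
  -- applies to the flipped matrix. Exposing predecessors turns (Y₁₂ - 1)(Y₁₃ - 1) into `p ℕ.* q`.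
  frobenius-below : Coprime Y₁₂ Y₁₃ → 0ℤ < Y₁₂ → 0ℤ < Y₁₃ → 0ℤ < Y₂₃ → 0ℤ < D → 0ℤ ≤ E →
                    ∃[ f ] IsFrobenius M n f × f * D < Y₁₂ * Y₁₃ - Y₁₂ - Y₁₃ + 1ℤ
  frobenius-below coprime 0<Y₁₂ 0<Y₁₃ 0<Y₂₃ 0<D 0≤E
    with 0<⇒+suc 0<Y₁₂ | 0<⇒+suc 0<Y₁₃ | 0<⇒+suc 0<Y₂₃ | 0<⇒+suc 0<D | 0≤⇒+ 0≤E
  ... | p , Y₁₂≡ | q , Y₁₃≡ | r , Y₂₃≡ | d , D≡ | e , E≡ =
    -- Since D ≥ 1, the crude threshold k ≥ p q already gives k D ≥ p q. It serves only for the
    -- existence of f; the sharp estimate is `bound`.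
    case largest-failure solvable? ¬solvable[-1] (p ℕ.* q) (λ k pq≤k → large⇒solvable k (ℕ.≤-trans pq≤k (ℕ.m≤m*n k (suc d)))) of λ where
      (f , largest@(¬solvable , _)) → f , largest , bound f ¬solvable
    where
    toSystem : ∀ k → Solvable M n (+ k) → System (suc p) (suc q) (suc r) (suc d) e k
    toSystem k s@(c , _) = c 2F , c 1F , c 0F ,
      ℤ.+-injective (begin
        + (suc p ℕ.* c 1F ℕ.+ suc q ℕ.* c 2F)     ≡⟨ cong₂ _+_ (ℤ.pos-* (suc p) (c 1F)) (ℤ.pos-* (suc q) (c 2F)) ⟩
        + suc p * + c 1F + + suc q * + c 2F       ≡⟨ cong₂ (λ i j → i * + c 1F + j * + c 2F) Y₁₂≡ Y₁₃≡ ⟨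
        Y₁₂ * + c 1F + Y₁₃ * + c 2F               ≡⟨ det-first (+ k) s ⟩
        + k * D                                   ≡⟨ cong (+ k *_) D≡ ⟩
        + k * + suc d                             ≡⟨ ℤ.pos-* k (suc d) ⟨
        + (k ℕ.* suc d)                           ∎) ,
      ℤ.+-injective (begin
        + (suc p ℕ.* c 0F)                        ≡⟨ ℤ.pos-* (suc p) (c 0F) ⟩
        + suc p * + c 0F                          ≡⟨ cong (_* + c 0F) Y₁₂≡ ⟨
        Y₁₂ * + c 0F                              ≡⟨ det-second (+ k) s ⟩
        + k * E + Y₂₃ * + c 2F                    ≡⟨ cong₂ (λ i j → + k * i + j * + c 2F) E≡ Y₂₃≡ ⟩
        + k * + e + + suc r * + c 2F              ≡⟨ cong₂ _+_ (ℤ.pos-* k e) (ℤ.pos-* (suc r) (c 2F)) ⟨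
        + (k ℕ.* e ℕ.+ suc r ℕ.* c 2F)            ∎)

    fromSystem : ∀ k → System (suc p) (suc q) (suc r) (suc d) e k → Solvable M n (+ k)
    fromSystem k (c , b , a , eq₁ , eq₂) =
      dets⇒solvable (+ k) {{subst NonZero (sym Y₁₂≡) _}} (λ { 0F → a ; 1F → b ; 2F → c })
        (begin
          Y₁₂ * + b + Y₁₃ * + c                   ≡⟨ cong₂ (λ i j → i * + b + j * + c) Y₁₂≡ Y₁₃≡ ⟩
          + suc p * + b + + suc q * + c           ≡⟨ cong₂ _+_ (ℤ.pos-* (suc p) b) (ℤ.pos-* (suc q) c) ⟨
          + (suc p ℕ.* b ℕ.+ suc q ℕ.* c)         ≡⟨ cong +_ eq₁ ⟩
          + (k ℕ.* suc d)                         ≡⟨ ℤ.pos-* k (suc d) ⟩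
          + k * + suc d                           ≡⟨ cong (+ k *_) D≡ ⟨
          + k * D                                 ∎)
        (begin
          Y₁₂ * + a                               ≡⟨ cong (_* + a) Y₁₂≡ ⟩
          + suc p * + a                           ≡⟨ ℤ.pos-* (suc p) a ⟨
          + (suc p ℕ.* a)                         ≡⟨ cong +_ eq₂ ⟩
          + (k ℕ.* e ℕ.+ suc r ℕ.* c)             ≡⟨ cong₂ _+_ (ℤ.pos-* k e) (ℤ.pos-* (suc r) c) ⟩
          + k * + e + + suc r * + c               ≡⟨ cong₂ (λ i j → + k * i + j * + c) E≡ Y₂₃≡ ⟨
          + k * E + Y₂₃ * + c                     ∎)

    solvable? : ∀ k → Dec (Solvable M n (+ k))
    solvable? k = map′ (fromSystem k) (toSystem k) (system? p q (suc r) (suc d) e k)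

    ¬solvable[-1] : ¬ Solvable M n -1ℤ
    -- The first determinant equation would equate a natural number with - D < 0.
    ¬solvable[-1] s@(c , _) = case (begin
      + (suc p ℕ.* c 1F ℕ.+ suc q ℕ.* c 2F)     ≡⟨ cong₂ _+_ (ℤ.pos-* (suc p) (c 1F)) (ℤ.pos-* (suc q) (c 2F)) ⟩
      + suc p * + c 1F + + suc q * + c 2F       ≡⟨ cong₂ (λ i j → i * + c 1F + j * + c 2F) Y₁₂≡ Y₁₃≡ ⟨
      Y₁₂ * + c 1F + Y₁₃ * + c 2F               ≡⟨ det-first -1ℤ s ⟩
      -1ℤ * D                                   ≡⟨ cong (-1ℤ *_) D≡ ⟩
      -1ℤ * + suc d                             ∎) of λ ()

    p∣dr+eq : suc p ℕ.∣ suc d ℕ.* suc r ℕ.+ e ℕ.* suc q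
    p∣dr+eq = ℕ.divides ∣ n₁ * y₃ - x₃ * n₂ ∣ (begin
      suc d ℕ.* suc r ℕ.+ e ℕ.* suc q           ≡⟨ cong ∣_∣ (cong₂ _+_ (ℤ.pos-* (suc d) (suc r)) (ℤ.pos-* e (suc q))) ⟩
      ∣ + suc d * + suc r + + e * + suc q ∣     ≡⟨ cong ∣_∣ (cong₂ _+_ (cong₂ _*_ D≡ Y₂₃≡) (cong₂ _*_ E≡ Y₁₃≡)) ⟨
      ∣ D * Y₂₃ + E * Y₁₃ ∣                     ≡⟨ cong ∣_∣ plücker ⟩
      ∣ Y₁₂ * (n₁ * y₃ - x₃ * n₂) ∣             ≡⟨ ℤ.abs-* Y₁₂ (n₁ * y₃ - x₃ * n₂) ⟩
      ∣ Y₁₂ ∣ ℕ.* ∣ n₁ * y₃ - x₃ * n₂ ∣         ≡⟨ cong (ℕ._* ∣ n₁ * y₃ - x₃ * n₂ ∣) (cong ∣_∣ Y₁₂≡) ⟩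
      suc p ℕ.* ∣ n₁ * y₃ - x₃ * n₂ ∣           ≡⟨ ℕ.*-comm (suc p) _ ⟩
      ∣ n₁ * y₃ - x₃ * n₂ ∣ ℕ.* suc p           ∎)

    large⇒solvable : ∀ k → p ℕ.* q ℕ.≤ k ℕ.* suc d → Solvable M n (+ k)
    large⇒solvable k pq≤kd =
      fromSystem k (system-solvable {d = suc d} {e} (subst₂ Coprime Y₁₂≡ Y₁₃≡ coprime) p∣dr+eq k pq≤kd)

    pq≡ : + (p ℕ.* q) ≡ Y₁₂ * Y₁₃ - Y₁₂ - Y₁₃ + 1ℤ
    pq≡ = begin
      + (p ℕ.* q)                                    ≡⟨ ℤ.pos-* p q ⟩
      + p * + q                                      ≡⟨ expand (+ p) (+ q) ⟩
      (1ℤ + + p) * (1ℤ + + q) - (1ℤ + + p) - (1ℤ + + q) + 1ℤ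
                                                     ≡⟨ cong₂ (λ i j → i * j - i - j + 1ℤ) Y₁₂≡ Y₁₃≡ ⟨
      Y₁₂ * Y₁₃ - Y₁₂ - Y₁₃ + 1ℤ                     ∎
      where
      expand : ∀ p q → p * q ≡ (1ℤ + p) * (1ℤ + q) - (1ℤ + p) - (1ℤ + q) + 1ℤ
      expand = solve-∀

    bound : ∀ f → ¬ Solvable M n f → f * D < Y₁₂ * Y₁₃ - Y₁₂ - Y₁₃ + 1ℤ
    -- A natural unsolvable f must violate p q ≤ f D; for a negative f the product f D is negative
    -- while p q is not.
    bound (+ k)    ¬solvable = subst₂ _<_ (trans (ℤ.pos-* k (suc d)) (cong (+ k *_) (sym D≡))) pq≡
      (+<+ (ℕ.≰⇒> (¬solvable ∘ large⇒solvable k)))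
    bound -[1+ k ] _         = subst₂ _<_ (cong (-[1+ k ] *_) (sym D≡)) pq≡ -<+

-- Determinants, signs and slopes over the rationals.

fromℤ-* : ∀ i j → fromℤ (i * j) ≡ fromℤ i ℚ.* fromℤ j
fromℤ-* i j = ℚ.toℚᵘ-injective (ℚᵘ.≃-sym (ℚ.toℚᵘ-homo-* (fromℤ i) (fromℤ j)))

fromℤ-neg : ∀ i → fromℤ (- i) ≡ ℚ.- fromℤ i
fromℤ-neg +0       = refl
fromℤ-neg +[1+ _ ] = refl
fromℤ-neg -[1+ _ ] = refl

fromℤ-+ : ∀ i j → fromℤ (i + j) ≡ fromℤ i ℚ.+ fromℤ j
fromℤ-+ i j = ℚ.toℚᵘ-injective (ℚᵘ.≃-trans
  (ℚᵘ.≃-reflexive (cong (λ k → ℚ.toℚᵘ (fromℤ k)) (sym (cong₂ _+_ (ℤ.*-identityʳ i) (ℤ.*-identityʳ j)))))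
  (ℚᵘ.≃-sym (ℚ.toℚᵘ-homo-+ (fromℤ i) (fromℤ j))))

detℚ : ℚ² → ℚ² → ℚ
detℚ u v = u 0F ℚ.* v 1F ℚ.- v 0F ℚ.* u 1F

fromℤ-det : ∀ u v → fromℤ (det u v) ≡ detℚ (embed u) (embed v)
fromℤ-det u v = begin
  fromℤ (i - j)                ≡⟨ fromℤ-+ i (- j) ⟩
  fromℤ i ℚ.+ fromℤ (- j)      ≡⟨ cong (fromℤ i ℚ.+_) (fromℤ-neg j) ⟩
  fromℤ i ℚ.- fromℤ j          ≡⟨ cong₂ ℚ._-_ (fromℤ-* (u 0F) (v 1F)) (fromℤ-* (v 0F) (u 1F)) ⟩
  detℚ (embed u) (embed v)     ∎
  where
  open ≡-Reasoning
  i = u 0F * v 1F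
  j = v 0F * u 1F

0<fromℤ : ∀ {i} → 0ℤ < i → 0ℚ ℚ.< fromℤ i
0<fromℤ {i} 0<i = ℚ.*<* (subst (0ℤ <_) (sym (ℤ.*-identityʳ i)) 0<i)

0<fromℤ⁻¹ : ∀ {i} → 0ℚ ℚ.< fromℤ i → 0ℤ < i
0<fromℤ⁻¹ {i} 0<i = subst (0ℤ <_) (ℤ.*-identityʳ i) (ℚ.drop-*<* 0<i)

0≤fromℤ⁻¹ : ∀ {i} → 0ℚ ℚ.≤ fromℤ i → 0ℤ ≤ i
0≤fromℤ⁻¹ {i} 0≤i = subst (0ℤ ≤_) (ℤ.*-identityʳ i) (ℚ.drop-*≤* 0≤i)

pos*pos : ∀ {p q} → 0ℚ ℚ.< p → 0ℚ ℚ.< q → 0ℚ ℚ.< p ℚ.* q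
pos*pos {p} {q} 0<p 0<q = ℚ.positive⁻¹ (p ℚ.* q) {{ℚ.pos*pos⇒pos p {{ℚ.positive 0<p}} q {{ℚ.positive 0<q}}}}

neg*pos : ∀ {p q} → p ℚ.< 0ℚ → 0ℚ ℚ.< q → p ℚ.* q ℚ.< 0ℚ
neg*pos {p} {q} p<0 0<q = ℚ.negative⁻¹ (p ℚ.* q) {{ℚ.neg*pos⇒neg p {{ℚ.negative p<0}} q {{ℚ.positive 0<q}}}}

nonNeg*nonNeg : ∀ {p q} → 0ℚ ℚ.≤ p → 0ℚ ℚ.≤ q → 0ℚ ℚ.≤ p ℚ.* q
nonNeg*nonNeg {p} {q} 0≤p 0≤q =
  ℚ.nonNegative⁻¹ (p ℚ.* q) {{ℚ.nonNeg*nonNeg⇒nonNeg p {{ℚ.nonNegative 0≤p}} q {{ℚ.nonNegative 0≤q}}}}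

0≤p² : ∀ p → 0ℚ ℚ.≤ p ℚ.* p
0≤p² p with ℚ.≤-total 0ℚ p
... | inj₁ 0≤p = nonNeg*nonNeg 0≤p 0≤p
... | inj₂ p≤0 = subst (0ℚ ℚ.≤_) (solve 1 (λ p → :- p :* :- p := p :* p) refl p)
                   (nonNeg*nonNeg (ℚ.neg-antimono-≤ p≤0) (ℚ.neg-antimono-≤ p≤0))

SameSign : ℚ → ℚ → Set
SameSign p q = 0ℚ ℚ.< p ℚ.* q

sameSign-sym : ∀ {p q} → SameSign p q → SameSign q p
sameSign-sym {p} {q} = subst (0ℚ ℚ.<_) (ℚ.*-comm p q)

-- (p q)(q r) = q² (p r), and the factor q² can be cancelled.
sameSign-trans : ∀ {p q r} → SameSign p q → SameSign q r → SameSign p r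
sameSign-trans {p} {q} {r} 0<pq 0<qr = ℚ.*-cancelˡ-<-nonNeg (q ℚ.* q) {{ℚ.nonNegative (0≤p² q)}}
  (subst₂ ℚ._<_ (sym (ℚ.*-zeroʳ (q ℚ.* q)))
    (solve 3 (λ p q r → (p :* q) :* (q :* r) := (q :* q) :* (p :* r)) refl p q r)
    (pos*pos 0<pq 0<qr))

0<q-p : ∀ {p q} → p ℚ.< q → 0ℚ ℚ.< q ℚ.- p
0<q-p {p} {q} p<q = subst (ℚ._< q ℚ.- p) (ℚ.+-inverseʳ p) (ℚ.+-monoˡ-< (ℚ.- p) p<q)

-- The bridge from slopes to orientations: the order of the slopes fixes the sign of the determinant
-- only relative to that of the product of the first coordinates.
detℚ-slope : ∀ u v .{{_ : ℚ.NonZero (u 0F)}} .{{_ : ℚ.NonZero (v 0F)}} →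
             detℚ u v ≡ u 0F ℚ.* v 0F ℚ.* (slope v ℚ.- slope u)
detℚ-slope u v = sym (begin
  a ℚ.* c ℚ.* (d ℚ.* c⁻¹ ℚ.- b ℚ.* a⁻¹)
    ≡⟨ solve 6 (λ a b c d a⁻¹ c⁻¹ →
         a :* c :* (d :* c⁻¹ :- b :* a⁻¹) := a :* d :* (c :* c⁻¹) :- c :* b :* (a :* a⁻¹))
         refl a b c d a⁻¹ c⁻¹ ⟩
  a ℚ.* d ℚ.* (c ℚ.* c⁻¹) ℚ.- c ℚ.* b ℚ.* (a ℚ.* a⁻¹)
    ≡⟨ cong₂ (λ i j → a ℚ.* d ℚ.* i ℚ.- c ℚ.* b ℚ.* j) (ℚ.*-inverseʳ c) (ℚ.*-inverseʳ a) ⟩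
  a ℚ.* d ℚ.* 1ℚ ℚ.- c ℚ.* b ℚ.* 1ℚ
    ≡⟨ cong₂ ℚ._-_ (ℚ.*-identityʳ (a ℚ.* d)) (ℚ.*-identityʳ (c ℚ.* b)) ⟩
  a ℚ.* d ℚ.- c ℚ.* b
    ∎)
  where
  open ≡-Reasoning
  a = u 0F
  b = u 1F
  c = v 0F
  d = v 1F
  a⁻¹ = ℚ.1/ a
  c⁻¹ = ℚ.1/ c

-- Closed half-planes and topological closure.

p≤∣p∣ : ∀ p → p ℚ.≤ ℚ.∣ p ∣
p≤∣p∣ p with ℚ.≤-total 0ℚ p
... | inj₁ 0≤p = ℚ.≤-reflexive (sym (ℚ.0≤p⇒∣p∣≡p 0≤p))
... | inj₂ p≤0 = ℚ.≤-trans p≤0 (ℚ.0≤∣p∣ p)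

*-≤-∣∣ : ∀ a {x ε} → ℚ.∣ x ∣ ℚ.< ε → a ℚ.* x ℚ.≤ ℚ.∣ a ∣ ℚ.* ε
*-≤-∣∣ a {x} {ε} ∣x∣<ε = begin
  a ℚ.* x                  ≤⟨ p≤∣p∣ (a ℚ.* x) ⟩
  ℚ.∣ a ℚ.* x ∣            ≡⟨ ℚ.∣p*q∣≡∣p∣*∣q∣ a x ⟩
  ℚ.∣ a ∣ ℚ.* ℚ.∣ x ∣      ≤⟨ ℚ.*-monoˡ-≤-nonNeg ℚ.∣ a ∣ {{ℚ.∣-∣-nonNeg a}} (ℚ.<⇒≤ ∣x∣<ε) ⟩
  ℚ.∣ a ∣ ℚ.* ε            ∎
  where open ℚ.≤-Reasoning

-- A linear functional L is Lipschitz with constant |a| + |b| in the sup metric. If L p were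
-- negative, points of S close enough to p would have negative L as well.
closure-half-plane : ∀ {S : Pred ℚ² 0ℓ} a b → (∀ q → S q → 0ℚ ℚ.≤ a ℚ.* q 0F ℚ.+ b ℚ.* q 1F) →
                     ∀ p → Closure S p → 0ℚ ℚ.≤ a ℚ.* p 0F ℚ.+ b ℚ.* p 1F
closure-half-plane {S} a b 0≤L p p∈S̄ = ℚ.≮⇒≥ λ Lp<0 →
  let
    0<ε = pos*pos (ℚ.neg-antimono-< Lp<0) (ℚ.positive⁻¹ 1/m {{ℚ.1/pos⇒pos m}})
    q , q∈S , near = p∈S̄ ε 0<ε
  in ℚ.<-irrefl refl (ℚ.≤-<-trans (0≤L q q∈S) (near⇒L<0 q near 0<ε))
  where
  open ℚ.≤-Reasoning

  L : ℚ² → ℚ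
  L q = a ℚ.* q 0F ℚ.+ b ℚ.* q 1F

  m : ℚ
  -- The summand 1 keeps `m` positive when a = b = 0 and makes the estimate strict: L q ≤ L p + (|a|
  -- + |b|) ε < L p + m ε = 0.
  m = ℚ.∣ a ∣ ℚ.+ ℚ.∣ b ∣ ℚ.+ 1ℚ

  instance
    m>0 : ℚ.Positive m
    m>0 = ℚ.nonNeg+pos⇒pos (ℚ.∣ a ∣ ℚ.+ ℚ.∣ b ∣)
            {{ℚ.nonNegative (ℚ.+-mono-≤ (ℚ.0≤∣p∣ a) (ℚ.0≤∣p∣ b))}} 1ℚ

  1/m : ℚ
  1/m = (ℚ.1/ m) {{ℚ.pos⇒nonZero m}}

  ε : ℚ
  ε = ℚ.- L p ℚ.* 1/m

  near⇒L<0 : ∀ q → (∀ i → ℚ.∣ q i ℚ.- p i ∣ ℚ.< ε) → 0ℚ ℚ.< ε → L q ℚ.< 0ℚ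
  near⇒L<0 q near 0<ε = begin-strict
    L q
      ≡⟨ solve 6 (λ a b q₀ q₁ p₀ p₁ →
           a :* q₀ :+ b :* q₁ :=
           a :* p₀ :+ b :* p₁ :+ (a :* (q₀ :- p₀) :+ b :* (q₁ :- p₁)))
           refl a b (q 0F) (q 1F) (p 0F) (p 1F) ⟩
    L p ℚ.+ (a ℚ.* (q 0F ℚ.- p 0F) ℚ.+ b ℚ.* (q 1F ℚ.- p 1F))
      ≤⟨ ℚ.+-monoʳ-≤ (L p) (ℚ.+-mono-≤ (*-≤-∣∣ a (near 0F)) (*-≤-∣∣ b (near 1F))) ⟩
    L p ℚ.+ (ℚ.∣ a ∣ ℚ.* ε ℚ.+ ℚ.∣ b ∣ ℚ.* ε)
      ≡⟨ solve 4 (λ l a b ε →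
           l :+ (a :* ε :+ b :* ε) := l :+ (a :+ b) :* ε :+ con 0ℚ)
           refl (L p) ℚ.∣ a ∣ ℚ.∣ b ∣ ε ⟩
    L p ℚ.+ (ℚ.∣ a ∣ ℚ.+ ℚ.∣ b ∣) ℚ.* ε ℚ.+ 0ℚ
      <⟨ ℚ.+-monoʳ-< (L p ℚ.+ (ℚ.∣ a ∣ ℚ.+ ℚ.∣ b ∣) ℚ.* ε) 0<ε ⟩
    L p ℚ.+ (ℚ.∣ a ∣ ℚ.+ ℚ.∣ b ∣) ℚ.* ε ℚ.+ ε
      ≡⟨ solve 4 (λ l a b m⁻¹ →
           l :+ (a :+ b) :* (:- l :* m⁻¹) :+ :- l :* m⁻¹ :=
           l :- l :* ((a :+ b :+ con 1ℚ) :* m⁻¹))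
           refl (L p) ℚ.∣ a ∣ ℚ.∣ b ∣ 1/m ⟩
    L p ℚ.- L p ℚ.* (m ℚ.* 1/m)
      ≡⟨ cong (λ i → L p ℚ.- L p ℚ.* i) (ℚ.*-inverseʳ m {{ℚ.pos⇒nonZero m}}) ⟩
    L p ℚ.- L p ℚ.* 1ℚ
      ≡⟨ solve 1 (λ l → l :- l :* con 1ℚ := con 0ℚ) refl (L p) ⟩
    0ℚ
      ∎

-- The convex hull condition and the orientation of the columns.

nonNeg-weights⇒origin∈hull : ∀ M (w : Fin 3 → ℚ) → (∀ j → 0ℚ ℚ.≤ w j) → 0ℚ ℚ.< sumℚ w →
                             (∀ i → combination M w i ≡ 0ℚ) → ConvexHull M origin
nonNeg-weights⇒origin∈hull M w 0≤w 0<S Mw≡0 =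
  (λ j → w j ℚ.* s) , (λ j → nonNeg*nonNeg (0≤w j) 0≤s) , Σt≡1 , λ i → sym (begin
    M₁ i ℚ.* (w 0F ℚ.* s) ℚ.+ (M₂ i ℚ.* (w 1F ℚ.* s) ℚ.+ (M₃ i ℚ.* (w 2F ℚ.* s) ℚ.+ 0ℚ))
      ≡⟨ solve 7 (λ a b c w₁ w₂ w₃ s →
           a :* (w₁ :* s) :+ (b :* (w₂ :* s) :+ (c :* (w₃ :* s) :+ con 0ℚ)) :=
           (a :* w₁ :+ (b :* w₂ :+ (c :* w₃ :+ con 0ℚ))) :* s)
           refl (M₁ i) (M₂ i) (M₃ i) (w 0F) (w 1F) (w 2F) s ⟩
    combination M w i ℚ.* s
      ≡⟨ cong (ℚ._* s) (Mw≡0 i) ⟩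
    0ℚ ℚ.* s
      ≡⟨ ℚ.*-zeroˡ s ⟩
    0ℚ
      ∎)
  where
  open ≡-Reasoning

  instance
    S>0 : ℚ.Positive (sumℚ w)
    S>0 = ℚ.positive 0<S

  s : ℚ
  s = (ℚ.1/ sumℚ w) {{ℚ.pos⇒nonZero (sumℚ w)}}

  0≤s : 0ℚ ℚ.≤ s
  0≤s = ℚ.<⇒≤ (ℚ.positive⁻¹ s {{ℚ.1/pos⇒pos (sumℚ w)}})

  M₁ M₂ M₃ : Fin 2 → ℚ
  M₁ i = fromℤ (M i 0F)
  M₂ i = fromℤ (M i 1F)
  M₃ i = fromℤ (M i 2F)

  Σt≡1 : sumℚ (λ j → w j ℚ.* s) ≡ 1ℚ
  Σt≡1 = begin
    w 0F ℚ.* s ℚ.+ (w 1F ℚ.* s ℚ.+ (w 2F ℚ.* s ℚ.+ 0ℚ))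
      ≡⟨ solve 4 (λ w₁ w₂ w₃ s →
           w₁ :* s :+ (w₂ :* s :+ (w₃ :* s :+ con 0ℚ)) :=
           (w₁ :+ (w₂ :+ (w₃ :+ con 0ℚ))) :* s)
           refl (w 0F) (w 1F) (w 2F) s ⟩
    sumℚ w ℚ.* s
      ≡⟨ ℚ.*-inverseʳ (sumℚ w) {{ℚ.pos⇒nonZero (sumℚ w)}} ⟩
    1ℚ
      ∎

module Columns (M : Matrix) {{x≢0 : ∀ {j} → NonZero (M 0F j)}} where

  x : Fin 3 → ℚ
  x j = fromℤ (M 0F j)

  v : Fin 3 → ℚ²
  v j = embed (column M j)

  det-columns : ∀ j k → detℚ (v j) (v k) ≡ x j ℚ.* x k ℚ.* (columnSlope M k ℚ.- columnSlope M j)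
  det-columns j k = detℚ-slope (v j) (v k) {{x≢0 {j}}} {{x≢0 {k}}}

  fromℤ-Y : ∀ j k → fromℤ (Y M j k) ≡ detℚ (v j) (v k)
  fromℤ-Y j k = fromℤ-det (column M j) (column M k)

  sameSign⇒Y>0 : ∀ {j k} → columnSlope M j ℚ.< columnSlope M k → SameSign (x j) (x k) → 0ℤ < Y M j k
  sameSign⇒Y>0 {j} {k} sⱼ<sₖ same = 0<fromℤ⁻¹ (subst (0ℚ ℚ.<_)
    (sym (trans (fromℤ-Y j k) (det-columns j k))) (pos*pos same (0<q-p sⱼ<sₖ)))

  Y>0⇒sameSign : ∀ {j k} → columnSlope M j ℚ.< columnSlope M k → 0ℤ < Y M j k → SameSign (x j) (x k)
  Y>0⇒sameSign {j} {k} sⱼ<sₖ 0<Y = ℚ.*-cancelʳ-<-nonNeg (sₖ ℚ.- sⱼ) {{ℚ.nonNegative (ℚ.<⇒≤ (0<q-p sⱼ<sₖ))}}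
    (subst₂ ℚ._<_ (sym (ℚ.*-zeroˡ (sₖ ℚ.- sⱼ))) (trans (fromℤ-Y j k) (det-columns j k)) (0<fromℤ 0<Y))
    where
    sⱼ = columnSlope M j
    sₖ = columnSlope M k

  oppositeSign⇒det<0 : ∀ {j k} → columnSlope M j ℚ.< columnSlope M k → x j ℚ.* x k ℚ.< 0ℚ →
                       detℚ (v j) (v k) ℚ.< 0ℚ
  oppositeSign⇒det<0 {j} {k} sⱼ<sₖ xx<0 =
    subst (ℚ._< 0ℚ) (sym (det-columns j k)) (neg*pos xx<0 (0<q-p sⱼ<sₖ))

  xx≢0 : ∀ j k → x j ℚ.* x k ≢ 0ℚ
  xx≢0 j k xx≡0 = ℕ.≢-nonZero⁻¹ ∣ M 0F j * M 0F k ∣ {{ℤ.i*j≢0 (M 0F j) (M 0F k) {{x≢0 {j}}} {{x≢0 {k}}}}}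
    (cong (∣_∣ ∘ ℚ.numerator) (trans (fromℤ-* (M 0F j) (M 0F k)) xx≡0))

  -- If x₂ had the opposite sign, Y₂₃ v₁ − Y₁₃ v₂ + Y₁₂ v₃ = 0 would be a
  -- vanishing combination of the columns with coefficients of one sign.
  first-two-sameSign : ¬ ConvexHull M origin →
                       columnSlope M 0F ℚ.< columnSlope M 1F → columnSlope M 1F ℚ.< columnSlope M 2F →
                       0ℤ < Y M 0F 2F → SameSign (x 0F) (x 1F)
  first-two-sameSign 0∉hull s₁<s₂ s₂<s₃ 0<Y₁₃ with ℚ.<-cmp 0ℚ (x 0F ℚ.* x 1F)
  ... | tri< same _ _ = same
  ... | tri≈ _ 0≡xx _ = contradiction (sym 0≡xx) (xx≢0 0F 1F)
  ... | tri> _ _ x₁x₂<0 = contradiction (nonNeg-weights⇒origin∈hull M w 0≤w 0<Σw Mw≡0) 0∉hull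
    where
    w : Fin 3 → ℚ
    -- The relation is negated so that all weights are positive: x₂ opposite in sign to x₁ and x₃
    -- makes Y₁₂ and Y₂₃ negative, while Y₁₃ is positive.
    w 0F = ℚ.- detℚ (v 1F) (v 2F)
    w 1F = detℚ (v 0F) (v 2F)
    w 2F = ℚ.- detℚ (v 0F) (v 1F)

    x₂x₃<0 : x 1F ℚ.* x 2F ℚ.< 0ℚ
    x₂x₃<0 with ℚ.<-cmp 0ℚ (x 1F ℚ.* x 2F)
    -- Y₁₃ > 0 gives x₁ and x₃ the same sign, so x₂ cannot agree with x₃ without agreeing with x₁.
    ... | tri< same _ _ = contradiction x₁x₂<0 (ℚ.<-asym
            (sameSign-trans {x 0F} {x 2F} {x 1F} (Y>0⇒sameSign (ℚ.<-trans s₁<s₂ s₂<s₃) 0<Y₁₃) (sameSign-sym {x 1F} {x 2F} same)))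
    ... | tri≈ _ 0≡xx _ = contradiction (sym 0≡xx) (xx≢0 1F 2F)
    ... | tri> _ _ xx<0 = xx<0

    0<w : ∀ j → 0ℚ ℚ.< w j
    0<w 0F = ℚ.neg-antimono-< (oppositeSign⇒det<0 s₂<s₃ x₂x₃<0)
    0<w 1F = subst (0ℚ ℚ.<_) (fromℤ-Y 0F 2F) (0<fromℤ 0<Y₁₃)
    0<w 2F = ℚ.neg-antimono-< (oppositeSign⇒det<0 s₁<s₂ x₁x₂<0)

    0≤w : ∀ j → 0ℚ ℚ.≤ w j
    0≤w j = ℚ.<⇒≤ (0<w j)

    0<Σw : 0ℚ ℚ.< sumℚ w
    0<Σw = ℚ.+-mono-<-≤ (0<w 0F) (ℚ.+-mono-≤ (0≤w 1F) (ℚ.+-mono-≤ (0≤w 2F) ℚ.≤-refl))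

    vanishing-x : ∀ x₁ x₂ x₃ y₁ y₂ y₃ →
      x₁ ℚ.* (ℚ.- (x₂ ℚ.* y₃ ℚ.- x₃ ℚ.* y₂)) ℚ.+ (x₂ ℚ.* (x₁ ℚ.* y₃ ℚ.- x₃ ℚ.* y₁) ℚ.+
        (x₃ ℚ.* (ℚ.- (x₁ ℚ.* y₂ ℚ.- x₂ ℚ.* y₁)) ℚ.+ 0ℚ)) ≡ 0ℚ
    vanishing-x = solve 6 (λ x₁ x₂ x₃ y₁ y₂ y₃ →
      x₁ :* (:- (x₂ :* y₃ :- x₃ :* y₂)) :+ (x₂ :* (x₁ :* y₃ :- x₃ :* y₁) :+
        (x₃ :* (:- (x₁ :* y₂ :- x₂ :* y₁)) :+ con 0ℚ)) := con 0ℚ) refl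

    vanishing-y : ∀ x₁ x₂ x₃ y₁ y₂ y₃ →
      y₁ ℚ.* (ℚ.- (x₂ ℚ.* y₃ ℚ.- x₃ ℚ.* y₂)) ℚ.+ (y₂ ℚ.* (x₁ ℚ.* y₃ ℚ.- x₃ ℚ.* y₁) ℚ.+
        (y₃ ℚ.* (ℚ.- (x₁ ℚ.* y₂ ℚ.- x₂ ℚ.* y₁)) ℚ.+ 0ℚ)) ≡ 0ℚ
    vanishing-y = solve 6 (λ x₁ x₂ x₃ y₁ y₂ y₃ →
      y₁ :* (:- (x₂ :* y₃ :- x₃ :* y₂)) :+ (y₂ :* (x₁ :* y₃ :- x₃ :* y₁) :+
        (y₃ :* (:- (x₁ :* y₂ :- x₂ :* y₁)) :+ con 0ℚ)) := con 0ℚ) refl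

    Mw≡0 : ∀ i → combination M w i ≡ 0ℚ
    Mw≡0 0F = vanishing-x (x 0F) (x 1F) (x 2F) (v 0F 1F) (v 1F 1F) (v 2F 1F)
    Mw≡0 1F = vanishing-y (x 0F) (x 1F) (x 2F) (v 0F 1F) (v 1F 1F) (v 2F 1F)

  -- Linear inequalities on the cone and on the closed sectors.

  module SameSigns (same : ∀ j → SameSign (x 0F) (x j)) where

    all-sameSign : ∀ j k → SameSign (x j) (x k)
    all-sameSign j k = sameSign-trans {x j} {x 0F} {x k} (sameSign-sym {x 0F} {x j} (same j)) (same k)

    -- Every summand x_j x_k t_k is nonnegative. This fixes the sign of the factor that `detℚ-slope`
    -- leaves open for a point of the cone.
    cone-first : ∀ j q → Cone M q → 0ℚ ℚ.≤ x j ℚ.* q 0F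
    cone-first j q (t , 0≤t , q≡Mt) = subst (0ℚ ℚ.≤_)
      (trans (factor (x j) (x 0F) (x 1F) (x 2F) (t 0F) (t 1F) (t 2F)) (cong (x j ℚ.*_) (sym (q≡Mt 0F))))
      (ℚ.+-mono-≤ (term 0F) (ℚ.+-mono-≤ (term 1F) (ℚ.+-mono-≤ (term 2F) ℚ.≤-refl)))
      where
      term : ∀ k → 0ℚ ℚ.≤ x j ℚ.* x k ℚ.* t k
      term k = nonNeg*nonNeg (ℚ.<⇒≤ (all-sameSign j k)) (0≤t k)

      factor : ∀ z x₁ x₂ x₃ t₁ t₂ t₃ →
        z ℚ.* x₁ ℚ.* t₁ ℚ.+ (z ℚ.* x₂ ℚ.* t₂ ℚ.+ (z ℚ.* x₃ ℚ.* t₃ ℚ.+ 0ℚ)) ≡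
        z ℚ.* (x₁ ℚ.* t₁ ℚ.+ (x₂ ℚ.* t₂ ℚ.+ (x₃ ℚ.* t₃ ℚ.+ 0ℚ)))
      factor = solve 7 (λ z x₁ x₂ x₃ t₁ t₂ t₃ →
        z :* x₁ :* t₁ :+ (z :* x₂ :* t₂ :+ (z :* x₃ :* t₃ :+ con 0ℚ)) :=
        z :* (x₁ :* t₁ :+ (x₂ :* t₂ :+ (x₃ :* t₃ :+ con 0ℚ)))) refl

    -- The slope inequality becomes a linear one in q, and its weak form passes to the closure by
    -- `closure-half-plane`.
    sector-detˡ : ∀ {j k} q → Sector M j k q → 0ℚ ℚ.≤ detℚ (v j) q
    sector-detˡ {j} q (q∈cone , q≢0 , sⱼ<s , _) =
      subst (0ℚ ℚ.≤_) (sym (detℚ-slope (v j) q {{x≢0 {j}}} {{q≢0}}))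
        (nonNeg*nonNeg (cone-first j q q∈cone) (ℚ.<⇒≤ (0<q-p sⱼ<s)))

    sector-detʳ : ∀ {j k} q → Sector M j k q → 0ℚ ℚ.≤ detℚ q (v k)
    sector-detʳ {k = k} q (q∈cone , q≢0 , _ , s<sₖ) =
      subst (0ℚ ℚ.≤_) (sym (detℚ-slope q (v k) {{q≢0}} {{x≢0 {k}}}))
        (nonNeg*nonNeg (subst (0ℚ ℚ.≤_) (ℚ.*-comm (x k) (q 0F)) (cone-first k q q∈cone)) (ℚ.<⇒≤ (0<q-p s<sₖ)))

    closed-sector-detˡ : ∀ {j k} n → Closure (Sector M j k) (embed n) → 0ℤ ≤ det (column M j) n
    closed-sector-detˡ {j} n n∈S̄ = 0≤fromℤ⁻¹ (subst (0ℚ ℚ.≤_) (trans (functional (embed n)) (sym (fromℤ-det (column M j) n)))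
      (closure-half-plane (ℚ.- v j 1F) (v j 0F)
        (λ q q∈S → subst (0ℚ ℚ.≤_) (sym (functional q)) (sector-detˡ q q∈S)) (embed n) n∈S̄))
      where
      functional : ∀ q → ℚ.- v j 1F ℚ.* q 0F ℚ.+ v j 0F ℚ.* q 1F ≡ detℚ (v j) q
      functional q = solve 4 (λ x y p q → :- y :* p :+ x :* q := x :* q :- p :* y) refl (v j 0F) (v j 1F) (q 0F) (q 1F)

    closed-sector-detʳ : ∀ {j k} n → Closure (Sector M j k) (embed n) → 0ℤ ≤ det n (column M k)
    closed-sector-detʳ {k = k} n n∈S̄ = 0≤fromℤ⁻¹ (subst (0ℚ ℚ.≤_) (trans (functional (embed n)) (sym (fromℤ-det n (column M k))))
      (closure-half-plane (v k 1F) (ℚ.- v k 0F)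
        (λ q q∈S → subst (0ℚ ℚ.≤_) (sym (functional q)) (sector-detʳ q q∈S)) (embed n) n∈S̄))
      where
      functional : ∀ q → v k 1F ℚ.* q 0F ℚ.+ ℚ.- v k 0F ℚ.* q 1F ≡ detℚ q (v k)
      functional q = solve 4 (λ x y p q → y :* p :+ :- x :* q := p :* y :- x :* q) refl (v k 0F) (v k 1F) (q 0F) (q 1F)

-- Quotient form of the bound, and the symmetry exchanging the two sectors.

<-÷ℤ : ∀ f A d .{{_ : NonZero d}} → 0ℤ < d → f * d < A → fromℤ f ℚ.< A ÷ℤ d
<-÷ℤ f A d 0<d fd<A = ℚ.*-cancelʳ-<-nonNeg (fromℤ d) {{ℚ.nonNegative (ℚ.<⇒≤ (0<fromℤ 0<d))}}
  (subst₂ ℚ._<_ (fromℤ-* f d) A≡ (ℚ.*<* (subst₂ _<_ (sym (ℤ.*-identityʳ (f * d))) (sym (ℤ.*-identityʳ A)) fd<A)))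
  where
  A≡ : fromℤ A ≡ A ÷ℤ d ℚ.* fromℤ d
  A≡ = sym (trans (ℚ.*-assoc (fromℤ A) (ℚ.1/ fromℤ d) (fromℤ d))
             (trans (cong (fromℤ A ℚ.*_) (ℚ.*-inverseˡ (fromℤ d))) (ℚ.*-identityʳ (fromℤ A))))

-- Both the reflection and the reversal change the sign of every determinant, so
-- Y₁₂ , Y₁₃ , Y₂₃ become Y₂₃ , Y₁₃ , Y₁₂.
flip : Matrix → Matrix
flip M i j = M (opposite i) (opposite j)

flip-solvable : ∀ M n N → Solvable M n N → Solvable (flip M) (n ∘ opposite) N
flip-solvable M n N (c , eq) = c ∘ opposite , λ i → trans
  (reverse (M (opposite i) 0F * + c 0F) (M (opposite i) 1F * + c 1F) (M (opposite i) 2F * + c 2F)) (eq (opposite i))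
  where
  reverse : ∀ a b c → c + (b + (a + 0ℤ)) ≡ a + (b + (c + 0ℤ))
  reverse = solve-∀

flip-solvable⁻¹ : ∀ M n N → Solvable (flip M) (n ∘ opposite) N → Solvable M n N
flip-solvable⁻¹ M n N s with flip-solvable (flip M) (n ∘ opposite) N s
-- `opposite (opposite i)` reduces to `i` only at a concrete index, hence the split by rows.
... | c , eq = c , λ { 0F → eq 0F ; 1F → eq 1F }

flip-frobenius : ∀ M n f → IsFrobenius (flip M) (n ∘ opposite) f → IsFrobenius M n f
flip-frobenius M n f (¬solvable , largest) =
  ¬solvable ∘ flip-solvable M n f , λ K ¬solvableK → largest K (¬solvableK ∘ flip-solvable⁻¹ M n K)

-- A closed sector contains its boundary rays, where the denominator vanishes; the nonzero
-- denominator excludes them and makes the weak inequality strict.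
nonZero∧0≤⇒0< : ∀ i → {{NonZero i}} → 0ℤ ≤ i → 0ℤ < i
nonZero∧0≤⇒0< +[1+ _ ] _ = +<+ ℕ.z<s

theorem9 :
    (M : Matrix) {{x≢0 : ∀ {j} → NonZero (M 0F j)}} →
    let x₁ = M 0F 0F
        x₃ = M 0F 2F
        y₁ = M 1F 0F
        y₃ = M 1F 2F
        Y₁₂ = Y M 0F 1F
        Y₁₃ = Y M 0F 2F
        Y₂₃ = Y M 1F 2F
    in
    ¬ ConvexHull M origin →
    columnSlope M 0F ℚ.< columnSlope M 1F →
    columnSlope M 1F ℚ.< columnSlope M 2F →
    0ℤ < Y₁₃ →
    Coprime Y₁₂ Y₁₃ → Coprime Y₁₂ Y₂₃ → Coprime Y₁₃ Y₂₃ →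
    (∀ (n : ℤ²) →
       let n₁ = n 0F
           n₂ = n 1F
       in
       Ω̄₁ M n → {{_ : NonZero (n₂ * x₁ - n₁ * y₁)}} →
       ∃[ f ] IsFrobenius M n f ×
         fromℤ f ℚ.< (Y₁₂ * Y₁₃ - Y₁₂ - Y₁₃ + 1ℤ) ÷ℤ (n₂ * x₁ - n₁ * y₁))
    ×
    (∀ (n : ℤ²) →
       let n₁ = n 0F
           n₂ = n 1F
       in
       Ω̄₂ M n → {{_ : NonZero (n₁ * y₃ - n₂ * x₃)}} →
       ∃[ f ] IsFrobenius M n f ×
         fromℤ f ℚ.< (Y₂₃ * Y₁₃ - Y₂₃ - Y₁₃ + 1ℤ) ÷ℤ (n₁ * y₃ - n₂ * x₃))
theorem9 M {{x≢0}} 0∉hull s₁<s₂ s₂<s₃ 0<Y₁₃ coprime₁₂,₁₃ _ coprime₁₃,₂₃ = first , second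
  where
  open Columns M

  x₁~x₂ : SameSign (x 0F) (x 1F)
  x₁~x₂ = first-two-sameSign 0∉hull s₁<s₂ s₂<s₃ 0<Y₁₃

  x₁~x₃ : SameSign (x 0F) (x 2F)
  x₁~x₃ = Y>0⇒sameSign (ℚ.<-trans s₁<s₂ s₂<s₃) 0<Y₁₃

  x₁~x : ∀ j → SameSign (x 0F) (x j)
  x₁~x 0F = sameSign-trans {x 0F} {x 1F} {x 0F} x₁~x₂ (sameSign-sym {x 0F} {x 1F} x₁~x₂)
  x₁~x 1F = x₁~x₂
  x₁~x 2F = x₁~x₃

  open SameSigns x₁~x

  0<Y₁₂ : 0ℤ < Y M 0F 1F
  0<Y₁₂ = sameSign⇒Y>0 s₁<s₂ x₁~x₂

  0<Y₂₃ : 0ℤ < Y M 1F 2F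
  0<Y₂₃ = sameSign⇒Y>0 s₂<s₃ (all-sameSign 1F 2F)

  first : ∀ n → Ω̄₁ M n → {{_ : NonZero (n 1F * M 0F 0F - n 0F * M 1F 0F)}} →
          ∃[ f ] IsFrobenius M n f ×
            fromℤ f ℚ.< (Y M 0F 1F * Y M 0F 2F - Y M 0F 1F - Y M 0F 2F + 1ℤ) ÷ℤ (n 1F * M 0F 0F - n 0F * M 1F 0F)
  first n n∈Ω̄₁ =
    let f , frobenius , fD<A = frobenius-below M n coprime₁₂,₁₃ 0<Y₁₂ 0<Y₁₃ 0<Y₂₃ 0<D (closed-sector-detʳ n n∈Ω̄₁)
    in f , frobenius , <-÷ℤ f (Y M 0F 1F * Y M 0F 2F - Y M 0F 1F - Y M 0F 2F + 1ℤ) D 0<D fD<A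
    where
    D : ℤ
    D = n 1F * M 0F 0F - n 0F * M 1F 0F
    0<D : 0ℤ < D
    0<D = nonZero∧0≤⇒0< D (subst (λ i → 0ℤ ≤ i - n 0F * M 1F 0F) (ℤ.*-comm (M 0F 0F) (n 1F)) (closed-sector-detˡ n n∈Ω̄₁))

  second : ∀ n → Ω̄₂ M n → {{_ : NonZero (n 0F * M 1F 2F - n 1F * M 0F 2F)}} →
           ∃[ f ] IsFrobenius M n f ×
             fromℤ f ℚ.< (Y M 1F 2F * Y M 0F 2F - Y M 1F 2F - Y M 0F 2F + 1ℤ) ÷ℤ (n 0F * M 1F 2F - n 1F * M 0F 2F)
  second n n∈Ω̄₂ =
    -- For the flipped data `D` unfolds to n₁ y₃ - n₂ x₃, and `E` is det (v₂ , n) up to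
    -- commutativity, so the two sides of the sector trade roles.
    let f , frobenius , fD<A = frobenius-below (flip M) (n ∘ opposite)
          (subst₂ Coprime (Y-flip 1F 2F) (Y-flip 0F 2F) (ℤ.sym {Y M 0F 2F} {Y M 1F 2F} coprime₁₃,₂₃))
          (subst (0ℤ <_) (Y-flip 1F 2F) 0<Y₂₃)
          (subst (0ℤ <_) (Y-flip 0F 2F) 0<Y₁₃)
          (subst (0ℤ <_) (Y-flip 0F 1F) 0<Y₁₂)
          0<D
          (subst (0ℤ ≤_) (cong₂ _-_ (ℤ.*-comm (M 0F 1F) (n 1F)) (ℤ.*-comm (n 0F) (M 1F 1F))) (closed-sector-detˡ n n∈Ω̄₂))
    in f , flip-frobenius M n f frobenius ,
       <-÷ℤ f (Y M 1F 2F * Y M 0F 2F - Y M 1F 2F - Y M 0F 2F + 1ℤ) D 0<D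
         (subst (f * D <_) (sym (cong₂ (λ i j → i * j - i - j + 1ℤ) (Y-flip 1F 2F) (Y-flip 0F 2F))) fD<A)
    where
    D : ℤ
    D = n 0F * M 1F 2F - n 1F * M 0F 2F
    0<D : 0ℤ < D
    0<D = nonZero∧0≤⇒0< D (subst (λ i → 0ℤ ≤ n 0F * M 1F 2F - i) (ℤ.*-comm (M 0F 2F) (n 1F)) (closed-sector-detʳ n n∈Ω̄₂))
    -- At concrete indices the right side is the unfolding of
    -- `Y (flip M) (opposite k) (opposite j)`.
    Y-flip : ∀ j k → Y M j k ≡ M 1F k * M 0F j - M 1F j * M 0F k
    Y-flip j k = cong₂ _-_ (ℤ.*-comm (M 0F j) (M 1F k)) (ℤ.*-comm (M 0F k) (M 1F j))
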